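{- Let \(m\) be a positive integer that is not a perfect square, let \(a,b,c\) be positive integers with \(\gcd(am,b^2-c^2m)=1\), and let \(A,B\in\mathbb Z\). If \(A\geq abm+acm-am-cm-b+1\) and \(B\geq acm+ab-a-b-c+1\), then there exist \(x,y,z,w\in\mathbb N\) with \(a\sqrt m(x+y\sqrt m)+(b+c\sqrt m)(z+w\sqrt m)=A+B\sqrt m\).
   Context: \(\mathbb N\) denotes the set of non-negative integers. -}

module Defs where

open import Data.Integer using (ℤ; 0ℤ; 1ℤ; _+_; _*_)
open import Data.Integer.Properties using (+-identityˡ; *-identityʳ)
open import Relation.Binary.PropositionalEquality using (_≡_; cong; trans)

-- The ring ℤ[√d] = ℤ[X]/(X² - d) in the basis 1, √d.  When d is positive and
-- not a perfect square, 1 and the real number √d are linearly independent over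
-- ℚ, so this is the subring ℤ[√d] of ℝ, and equality of coordinates is equality
-- of real numbers.
record ℤ[√_] (d : ℤ) : Set where
  constructor ⟨_,_⟩
  field
    rat : ℤ
    irr : ℤ

infixl 6 _⊕_
infixl 7 _⊗_

_⊕_ : ∀ {d} → ℤ[√ d ] → ℤ[√ d ] → ℤ[√ d ]
⟨ p , q ⟩ ⊕ ⟨ r , s ⟩ = ⟨ p + r , q + s ⟩

_⊗_ : ∀ {d} → ℤ[√ d ] → ℤ[√ d ] → ℤ[√ d ]
_⊗_ {d} ⟨ p , q ⟩ ⟨ r , s ⟩ = ⟨ p * r + d * (q * s) , p * s + q * r ⟩

ι : ∀ {d} → ℤ → ℤ[√ d ]
ι n = ⟨ n , 0ℤ ⟩

√ : ∀ d → ℤ[√ d ]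
√ d = ⟨ 0ℤ , 1ℤ ⟩

√⊗√≡d : ∀ d → √ d ⊗ √ d ≡ ι d
√⊗√≡d d = cong ι (trans (+-identityˡ (d * 1ℤ)) (*-identityʳ d))

{-# OPTIONS --safe #-}

-- Comparing coordinates, the equation is the system
--   a m y + b z + c m w = A,   a x + c z + b w = B.
-- The determinant b² - c² m of the (z, w)-part is invertible modulo a m, so
-- Cramer's rule solves the system modulo a m.  Both congruences (modulo a m and
-- modulo a) survive reducing z modulo a m and w modulo a.  With
-- 0 ≤ z ≤ a m - 1 and 0 ≤ w ≤ a - 1 the lower bounds on A and B say exactly that
-- a m y > - a m and a x > - a, hence x and y are non-negative.

module Submission where

open import Defs
open import Data.Nat using (ℕ; s≤s; z≤n)
import Data.Nat as ℕ
open import Data.Nat.GCD using (GCD; gcd-GCD; module Bézout)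
open import Data.Integer using (ℤ; +_; 0ℤ; 1ℤ; _+_; _-_; _*_; _^_; _<_; _≥_)
open import Data.Integer using (-_; _≤_; +<+; ∣_∣; nonNegative; >-nonZero)
open import Data.Integer.DivMod using (_/_; _%_; n%d<d; a≡a%n+[a/n]*n)
open import Data.Integer.GCD using (gcd)
open import Data.Integer.Properties
open import Data.Integer.Tactic.RingSolver using (solve-∀)
open import Data.Product using (∃-syntax; Σ-syntax; _×_; _,_)
open import Data.Sum using (inj₁; inj₂)
open import Relation.Nullary using (¬_)
open import Relation.Binary.PropositionalEquality using (_≡_; sym; trans; cong; cong₂; subst; subst₂; module ≡-Reasoning)

0<i⇒0<j⇒0<i*j : ∀ {i j} → 0ℤ < i → 0ℤ < j → 0ℤ < i * j
0<i⇒0<j⇒0<i*j (+<+ (s≤s _)) (+<+ (s≤s _)) = +<+ (s≤s z≤n)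

i≡i+j-j : ∀ i j → i ≡ i + j - j
i≡i+j-j = solve-∀

-- The sign enters as a multiplier `s`, so that it can be absorbed into a Bézout coefficient.
+∣i∣≡s*i : ∀ i → ∃[ s ] + ∣ i ∣ ≡ s * i
+∣i∣≡s*i i with +∣i∣≡i⊎+∣i∣≡-i i
... | inj₁ eq = 1ℤ , trans eq (sym (*-identityˡ i))
... | inj₂ eq = - 1ℤ , trans eq (sym (-1*i≡-i i))

pos-difference : ∀ {d} k l m n → d ℕ.+ l ℕ.* n ≡ k ℕ.* m → + k * + m - + l * + n ≡ + d
pos-difference {d} k l m n eq = begin
  + k * + m - + l * + n         ≡⟨ cong (_- + l * + n) (pos-* k m) ⟨
  + (k ℕ.* m) - + l * + n       ≡⟨ cong (λ i → + i - + l * + n) eq ⟨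
  + d + + (l ℕ.* n) - + l * + n ≡⟨ cong (λ i → + d + i - + l * + n) (pos-* l n) ⟩
  + d + + l * + n - + l * + n   ≡⟨ i≡i+j-j (+ d) (+ l * + n) ⟨
  + d                           ∎
  where open ≡-Reasoning

-- The identity over ℕ concerns ∣ i ∣ and ∣ j ∣ and comes in two orientations, according to which
-- multiple is the larger. The signs `s` and `t` carry either one over to `i` and `j`.
bézout : ∀ i j → gcd i j ≡ 1ℤ → ∃[ u ] ∃[ v ] u * i + v * j ≡ 1ℤ
bézout i j gcd≡1
  with s , ∣i∣≡ ← +∣i∣≡s*i i | t , ∣j∣≡ ← +∣i∣≡s*i j
  with Bézout.identity (subst (GCD ∣ i ∣ ∣ j ∣) (+-injective gcd≡1) (gcd-GCD ∣ i ∣ ∣ j ∣))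
... | Bézout.+- x y eq = + x * s , - (+ y * t) , (begin
  + x * s * i + - (+ y * t) * j ≡⟨ regroup (+ x) s i (+ y) t j ⟩
  + x * (s * i) - + y * (t * j) ≡⟨ cong₂ (λ p q → + x * p - + y * q) ∣i∣≡ ∣j∣≡ ⟨
  + x * + ∣ i ∣ - + y * + ∣ j ∣ ≡⟨ pos-difference x y ∣ i ∣ ∣ j ∣ eq ⟩
  1ℤ                            ∎)
  where
  open ≡-Reasoning
  regroup : ∀ x s i y t j → x * s * i + - (y * t) * j ≡ x * (s * i) - y * (t * j)
  regroup = solve-∀
... | Bézout.-+ x y eq = - (+ x * s) , + y * t , (begin
  - (+ x * s) * i + + y * t * j ≡⟨ regroup (+ x) s i (+ y) t j ⟩
  + y * (t * j) - + x * (s * i) ≡⟨ cong₂ (λ p q → + y * q - + x * p) ∣i∣≡ ∣j∣≡ ⟨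
  + y * + ∣ j ∣ - + x * + ∣ i ∣ ≡⟨ pos-difference y x ∣ j ∣ ∣ i ∣ eq ⟩
  1ℤ                            ∎)
  where
  open ≡-Reasoning
  regroup : ∀ x s i y t j → - (x * s) * i + y * t * j ≡ y * (t * j) - x * (s * i)
  regroup = solve-∀

residue : ∀ {n} → 0ℤ < n → ∀ i → Σ[ r ∈ ℕ ] ∃[ q ] + r ≤ n - 1ℤ × + r ≡ i - q * n
residue {n} 0<n i = i % n , i / n , r≤n-1 , (begin
  + (i % n)                         ≡⟨ i≡i+j-j (+ (i % n)) (i / n * n) ⟩
  + (i % n) + i / n * n - i / n * n ≡⟨ cong (_- i / n * n) (a≡a%n+[a/n]*n i n) ⟨
  i - i / n * n                     ∎)
  where
  open ≡-Reasoning
  instance _ = >-nonZero 0<n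
  r≤n-1 : + (i % n) ≤ n - 1ℤ
  -- The remainder is bounded by ∣ n ∣, which is `n` by positivity. The predecessor of `n` unfolds
  -- to - 1 + n, hence the commutation.
  r≤n-1 = subst (+ (i % n) ≤_) (+-comm (- 1ℤ) n)
    (i<j⇒i≤pred[j] (subst (+ (i % n) <_) (0≤i⇒+∣i∣≡i (<⇒≤ 0<n)) (+<+ (n%d<d i n))))

-- Since p and q are positive, pz + qw is at most pZ + qW, so the bound leaves ny ≥ 1 - n. Thus n(1
-- + y) ≥ 1 > 0, which forces 1 + y > 0, and y ≥ 0 because y is an integer.
quotient-nonNeg : ∀ {n p q Z W} → 0ℤ < n → 0ℤ < p → 0ℤ < q →
  ∀ {y z w} → z ≤ Z → w ≤ W →
  n * y + p * z + q * w ≥ p * Z + q * W - n + 1ℤ →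
  0ℤ ≤ y
quotient-nonNeg {n} {p} {q} {Z} {W} 0<n 0<p 0<q {y} {z} {w} z≤ w≤ bound =
  subst (0ℤ ≤_) (pred-suc y) (i<j⇒i≤pred[j] (*-cancelˡ-<-nonNeg n n*0<n*suc[y]))
  where
  open ≤-Reasoning
  instance
    n≥0 = nonNegative (<⇒≤ 0<n)
    p≥0 = nonNegative (<⇒≤ 0<p)
    q≥0 = nonNegative (<⇒≤ 0<q)
  n*0<n*suc[y] : n * 0ℤ < n * (1ℤ + y)
  n*0<n*suc[y] = begin-strict
    n * 0ℤ ≡⟨ *-zeroʳ n ⟩
    0ℤ     <⟨ +<+ (s≤s z≤n) ⟩
    1ℤ     ≡⟨ shift₁ n p q Z W 1ℤ ⟩
    p * Z + q * W - n + 1ℤ + (n - (p * Z + q * W))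
      ≤⟨ +-mono-≤ bound (+-monoʳ-≤ n (neg-mono-≤ (+-mono-≤ (*-monoˡ-≤-nonNeg p z≤) (*-monoˡ-≤-nonNeg q w≤)))) ⟩
    n * y + p * z + q * w + (n - (p * z + q * w)) ≡⟨ shift₂ n p q y z w ⟩
    n * (1ℤ + y) ∎
    where
    shift₁ : ∀ n p q Z W o → o ≡ p * Z + q * W - n + o + (n - (p * Z + q * W))
    shift₁ = solve-∀
    shift₂ : ∀ n p q y z w → n * y + p * z + q * w + (n - (p * z + q * w)) ≡ n * (1ℤ + y)
    shift₂ = solve-∀

ι⊕ι⊗√ : ∀ m A B → ι {m} A ⊕ ι B ⊗ √ m ≡ ⟨ A , B ⟩
ι⊕ι⊗√ m A B = cong₂ ⟨_,_⟩ (rat≡ m A B) (irr≡ A B)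
  where
  rat≡ : ∀ m A B → A + (B * 0ℤ + m * (0ℤ * 1ℤ)) ≡ A
  rat≡ = solve-∀
  irr≡ : ∀ A B → 0ℤ + (B * 1ℤ + 0ℤ * 0ℤ) ≡ B
  irr≡ = solve-∀

ι⊗√ : ∀ m a → ι {m} a ⊗ √ m ≡ ⟨ 0ℤ , a ⟩
ι⊗√ m a = cong₂ ⟨_,_⟩ (rat≡ m a) (irr≡ a)
  where
  rat≡ : ∀ m a → a * 0ℤ + m * (0ℤ * 1ℤ) ≡ 0ℤ
  rat≡ = solve-∀
  irr≡ : ∀ a → a * 1ℤ + 0ℤ * 0ℤ ≡ a
  irr≡ = solve-∀

coordinates : ∀ m a b c x y z w →
  ι {m} a ⊗ √ m ⊗ (ι x ⊕ ι y ⊗ √ m) ⊕ (ι b ⊕ ι c ⊗ √ m) ⊗ (ι z ⊕ ι w ⊗ √ m)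
    ≡ ⟨ a * m * y + b * z + c * m * w , a * x + c * z + b * w ⟩
coordinates m a b c x y z w = begin
  ι a ⊗ √ m ⊗ (ι x ⊕ ι y ⊗ √ m) ⊕ (ι b ⊕ ι c ⊗ √ m) ⊗ (ι z ⊕ ι w ⊗ √ m)
    ≡⟨ cong₂ _⊕_ (cong₂ _⊗_ (ι⊗√ m a) (ι⊕ι⊗√ m x y)) (cong₂ _⊗_ (ι⊕ι⊗√ m b c) (ι⊕ι⊗√ m z w)) ⟩
  ⟨ 0ℤ , a ⟩ ⊗ ⟨ x , y ⟩ ⊕ ⟨ b , c ⟩ ⊗ ⟨ z , w ⟩
    ≡⟨ cong₂ ⟨_,_⟩ (rat≡ m a b c x y z w) (irr≡ a b c x y z w) ⟩
  ⟨ a * m * y + b * z + c * m * w , a * x + c * z + b * w ⟩ ∎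
  where
  open ≡-Reasoning
  rat≡ : ∀ m a b c x y z w →
    0ℤ * x + m * (a * y) + (b * z + m * (c * w)) ≡ a * m * y + b * z + c * m * w
  rat≡ = solve-∀
  irr≡ : ∀ a b c x y z w →
    0ℤ * y + a * x + (b * w + c * z) ≡ a * x + c * z + b * w
  irr≡ = solve-∀

theorem3 : (m : ℤ) → 0ℤ < m → ¬ (∃[ k ] m ≡ k ^ 2) →
    (a b c : ℤ) → 0ℤ < a → 0ℤ < b → 0ℤ < c →
    gcd (a * m) (b ^ 2 - c ^ 2 * m) ≡ 1ℤ →
    (A B : ℤ) →
    A ≥ a * b * m + a * c * m - a * m - c * m - b + 1ℤ →
    B ≥ a * c * m + a * b - a - b - c + 1ℤ →
    Σ[ x ∈ ℕ ] Σ[ y ∈ ℕ ] Σ[ z ∈ ℕ ] Σ[ w ∈ ℕ ]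
    ι a ⊗ √ m ⊗ (ι (+ x) ⊕ ι (+ y) ⊗ √ m) ⊕ (ι b ⊕ ι c ⊗ √ m) ⊗ (ι (+ z) ⊕ ι (+ w) ⊗ √ m)
    ≡ ι A ⊕ ι B ⊗ √ m
theorem3 m 0<m _ a b c 0<a 0<b 0<c coprime A B A≥ B≥
  with u , v , uv≡1 ← bézout (a * m) (b ^ 2 - c ^ 2 * m) coprime
  -- By `uv≡1`, `v` inverts the determinant modulo am. The arguments of `residue` are `v` times the
  -- Cramer numerators. Modulus `a` is enough for `w`: in the first equation its coefficient cm
  -- supplies the missing factor m.
  with z , q , z≤ , z≡ ← residue (0<i⇒0<j⇒0<i*j 0<a 0<m) (v * (b * A - c * m * B))
     | w , r , w≤ , w≡ ← residue 0<a (v * (b * B - c * A))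
  = ∣ x ∣ , ∣ y ∣ , z , w , (begin
    _ ≡⟨ coordinates m a b c (+ ∣ x ∣) (+ ∣ y ∣) (+ z) (+ w) ⟩
    ⟨ a * m * + ∣ y ∣ + b * + z + c * m * + w , a * + ∣ x ∣ + c * + z + b * + w ⟩
      ≡⟨ cong₂ (λ x y → ⟨ a * m * y + b * + z + c * m * + w , a * x + c * + z + b * + w ⟩) (0≤i⇒+∣i∣≡i 0≤x) (0≤i⇒+∣i∣≡i 0≤y) ⟩
    ⟨ a * m * y + b * + z + c * m * + w , a * x + c * + z + b * + w ⟩
      ≡⟨ cong₂ ⟨_,_⟩ A-eq B-eq ⟩
    ⟨ A , B ⟩ ≡⟨ ι⊕ι⊗√ m A B ⟨
    ι A ⊕ ι B ⊗ √ m ∎)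
  where
  open ≡-Reasoning
  -- These are the exact quotients: substituting z and w and replacing 1 - v(b² - c²m) by uam gives
  -- A - bz - cmw = am(uA + bq + cr), and likewise a factor a splits off B - cz - bw.
  x = u * m * B + c * q * m + b * r
  y = u * A + b * q + c * r

  -- The terms in B, q and r cancel. The squares are spelled `b * (b * 1ℤ)`, to which `b ^ 2`
  -- unfolds, so that `uv≡1` rewrites the right-hand factor directly.
  A-identity : ∀ m a b c A B u v q r →
    a * m * (u * A + b * q + c * r) + b * (v * (b * A - c * m * B) - q * (a * m)) + c * m * (v * (b * B - c * A) - r * a)
      ≡ (u * (a * m) + v * (b * (b * 1ℤ) - c * (c * 1ℤ) * m)) * A
  A-identity = solve-∀

  B-identity : ∀ m a b c A B u v q r →
    a * (u * m * B + c * q * m + b * r) + c * (v * (b * A - c * m * B) - q * (a * m)) + b * (v * (b * B - c * A) - r * a)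
      ≡ (u * (a * m) + v * (b * (b * 1ℤ) - c * (c * 1ℤ) * m)) * B
  B-identity = solve-∀

  A-eq : a * m * y + b * + z + c * m * + w ≡ A
  A-eq = begin
    a * m * y + b * + z + c * m * + w ≡⟨ cong₂ (λ z w → a * m * y + b * z + c * m * w) z≡ w≡ ⟩
    _                                 ≡⟨ A-identity m a b c A B u v q r ⟩
    _                                 ≡⟨ cong (_* A) uv≡1 ⟩
    1ℤ * A                            ≡⟨ *-identityˡ A ⟩
    A                                 ∎

  B-eq : a * x + c * + z + b * + w ≡ B
  B-eq = begin
    a * x + c * + z + b * + w ≡⟨ cong₂ (λ z w → a * x + c * z + b * w) z≡ w≡ ⟩
    _                         ≡⟨ B-identity m a b c A B u v q r ⟩
    _                         ≡⟨ cong (_* B) uv≡1 ⟩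
    1ℤ * B                    ≡⟨ *-identityˡ B ⟩
    B                         ∎

  -- Exhibits the hypothesis on A in the shape required by `quotient-nonNeg`, with the largest
  -- residues am - 1 and a - 1 as `Z` and `W`.
  A-bound : ∀ m a b c → a * b * m + a * c * m - a * m - c * m - b + 1ℤ
    ≡ b * (a * m - 1ℤ) + c * m * (a - 1ℤ) - a * m + 1ℤ
  A-bound = solve-∀

  B-bound : ∀ m a b c → a * c * m + a * b - a - b - c + 1ℤ
    ≡ c * (a * m - 1ℤ) + b * (a - 1ℤ) - a + 1ℤ
  B-bound = solve-∀

  0≤y : 0ℤ ≤ y
  0≤y = quotient-nonNeg (0<i⇒0<j⇒0<i*j 0<a 0<m) 0<b (0<i⇒0<j⇒0<i*j 0<c 0<m) z≤ w≤
    (subst₂ _≤_ (A-bound m a b c) (sym A-eq) A≥)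

  0≤x : 0ℤ ≤ x
  0≤x = quotient-nonNeg 0<a 0<c 0<b z≤ w≤
    (subst₂ _≤_ (B-bound m a b c) (sym B-eq) B≥)
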